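{- For every positive integer $n$, $\hat{r}_c(nK_2,P_3)=\lfloor (5n-1)/2\rfloor$.
   Context: All graphs are finite and simple. $nK_2$ denotes a matching with $n$ edges, and $P_3$ denotes the path with 3 vertices (2 edges). For graphs $G, G_1, G_2$, write $G\to(G_1,G_2)$ if for every colouring of the edges of $G$ with red and blue, $G$ contains either a red copy of $G_1$ (all edges red) or a blue copy of $G_2$ (all edges blue). The connected size Ramsey number $\hat{r}_c(G_1,G_2)$ is the minimum number of edges of a connected graph $G$ with $G\to(G_1,G_2)$. -}

module Defs where

open import Data.Nat using (ℕ; zero; suc; _<_; _≤_; _∸_; _*_)
open import Data.Nat.DivMod using (_/_)
open import Data.Fin as Fin using (Fin)
open import Data.Bool using (Bool; true; false)
open import Data.Product using (Σ; _×_; _,_; proj₁; proj₂; ∃)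
open import Data.Sum using (_⊎_)
open import Data.List using (List; length)
open import Data.List.Membership.Propositional using (_∈_)
open import Data.List.Relation.Unary.All using (All)
open import Data.List.Relation.Unary.Unique.Propositional using (Unique)
open import Relation.Binary.PropositionalEquality using (_≡_)
open import Function.Definitions using (Injective)

-- A finite simple graph on vertex set Fin V, given by its list of edges;
-- each edge {i,j} is stored exactly once as (i , j) with i < j.
record SimpleGraph : Set where
  field
    V      : ℕ
    E      : List (Fin V × Fin V)
    sorted : All (λ e → proj₁ e Fin.< proj₂ e) E
    unique : Unique E
open SimpleGraph public

size : SimpleGraph → ℕ
size G = length (E G)

Adj : (G : SimpleGraph) → Fin (V G) → Fin (V G) → Set
Adj G x y = ((x , y) ∈ E G) ⊎ ((y , x) ∈ E G)

data Reach (G : SimpleGraph) : Fin (V G) → Fin (V G) → Set where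
  here : ∀ {x} → Reach G x x
  step : ∀ {x y z} → Adj G x y → Reach G y z → Reach G x z

Connected : SimpleGraph → Set
Connected G = (0 < V G) × (∀ x y → Reach G x y)

data Colour : Set where
  red blue : Colour

-- a red/blue edge colouring (only its values on edges (i , j) ∈ E, i < j, matter)
Colouring : SimpleGraph → Set
Colouring G = Fin (V G) → Fin (V G) → Colour

ColEdge : (G : SimpleGraph) → Colouring G → Colour → Fin (V G) → Fin (V G) → Set
ColEdge G c col x y = (((x , y) ∈ E G) × c x y ≡ col) ⊎ (((y , x) ∈ E G) × c y x ≡ col)

-- a (pattern) graph given by a vertex type and a symmetric-use edge relation
record Pattern : Set₁ where
  field
    PV  : Set
    PE  : PV → PV → Set
open Pattern public

HasMonoCopy : (G : SimpleGraph) → Colouring G → Colour → Pattern → Set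
HasMonoCopy G c col H =
  Σ (PV H → Fin (V G)) λ f → Injective _≡_ _≡_ f ×
    (∀ a b → PE H a b → ColEdge G c col (f a) (f b))

Arrows : SimpleGraph → Pattern → Pattern → Set
Arrows G H₁ H₂ = (c : Colouring G) → HasMonoCopy G c red H₁ ⊎ HasMonoCopy G c blue H₂

data MatchEdge {n : ℕ} : Fin n × Bool → Fin n × Bool → Set where
  medge : ∀ i → MatchEdge (i , false) (i , true)

nK₂ : ℕ → Pattern
nK₂ n = record { PV = Fin n × Bool ; PE = MatchEdge }

data P3Edge : Fin 3 → Fin 3 → Set where
  e01 : P3Edge Fin.zero (Fin.suc Fin.zero)
  e12 : P3Edge (Fin.suc Fin.zero) (Fin.suc (Fin.suc Fin.zero))

P₃ : Pattern
P₃ = record { PV = Fin 3 ; PE = P3Edge }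

IsConnSizeRamsey : Pattern → Pattern → ℕ → Set
IsConnSizeRamsey H₁ H₂ m =
  (Σ SimpleGraph λ G → Connected G × Arrows G H₁ H₂ × size G ≡ m) ×
  ((G : SimpleGraph) → Connected G → Arrows G H₁ H₂ → m ≤ size G)

{-# OPTIONS --safe #-}

-- Upper bound: ⌊n/2⌋ copies of C₄ strung together by single edges, plus a P₃ if n is odd.
--
-- Lower bound: every connected graph with m edges has a set C of at most (2m+2)/5 vertices such that
-- G − C has maximum degree at most 1.  Colour the edges of G − C blue and all others red: there is no
-- blue P₃, and a red matching has at most |C| edges because each of its edges meets C.
--
-- The set C is found by induction on G, as in a depth-first search.  Let v be a vertex with a connected
-- part Y of G − v fixed, and let K range over the components of G − v − Y.  Each K is either
-- reducible itself or a path on at most three vertices.  Put v into C and delete v together with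
-- all K not joined to Y (one more vertex of C is needed in each K that forms a C₄ with v); the rest stays
-- connected.  At least 5/2 edges per chosen vertex disappear, unless v together with its K is again a
-- path on at most three vertices, or is a path on four vertices with both ends joined to Y, where
-- choosing the two ends deletes five edges.
module Submission where

open import Defs
open import Data.Nat using (ℕ; _≤_; _*_; _∸_)
open import Data.Nat.DivMod using (_/_)
open import Data.Nat.DivMod using (m<n*o⇒m/o<n; +-distrib-/-∣ˡ)
open import Data.Nat.Divisibility using (divides)
open import Data.Nat using (zero; suc; _+_; _<_; z≤n; s≤s)
open import Data.Nat.Properties using (≤-refl; ≤-trans; ≤-reflexive; ≤-pred; +-mono-≤; +-monoʳ-≤; *-monoʳ-≤; +-cancelʳ-≤; m≤m+n; m≤n+m; +-assoc; suc-injective; m+n≡0⇒n≡0; module ≤-Reasoning)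
open import Data.Nat.Tactic.RingSolver using (solve-∀)
open import Data.Fin as Fin using (Fin)
open import Data.Fin.Properties using (<-irrefl; <-asym; injective⇒≤; ↑ˡ-injective)
open import Data.Fin.Patterns using (0F; 1F; 2F; 3F)
open import Data.Bool using (Bool; true; false)
open import Data.Empty using (⊥; ⊥-elim)
open import Data.Product as Product using (Σ; _×_; _,_; proj₁; proj₂; ∃)
open import Data.Sum as Sum using (_⊎_; inj₁; inj₂)
open import Data.Product.Properties using (≡-dec)
open import Data.List as List using (List; []; _∷_; _++_; length; concat; [_]; map; filter; allFin)
open import Data.List.Properties using (length-++; length-map)
open import Data.List.Membership.Propositional using (_∈_; _∉_)
open import Data.List.Membership.Propositional.Properties using (∈-++⁺ˡ; ∈-++⁺ʳ; ∈-++⁻; ∈-∃++; ∈-map⁺; ∈-map⁻; ∈-filter⁻; ∈-allFin)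
open import Data.List.Relation.Unary.Any as Any using (here; there)
open import Data.List.Relation.Unary.Any.Properties using (lookup-index)
open import Data.List.Relation.Unary.All as All using (All; []; _∷_)
open import Data.List.Relation.Unary.All.Properties as All using ()
open import Data.List.Relation.Unary.AllPairs using (AllPairs; []; _∷_)
import Data.List.Relation.Unary.AllPairs.Properties as AllPairs
open import Data.List.Relation.Unary.Unique.Propositional using (Unique)
open import Data.List.Relation.Unary.Unique.Propositional.Properties as Unique using (Unique[x∷xs]⇒x∉xs)
open import Data.List.Relation.Binary.Permutation.Propositional using (_↭_; refl; prep; swap; trans; ↭-refl; ↭-sym; ↭-trans; ↭⇒↭ₛ)
open import Data.List.Relation.Binary.Permutation.Propositional.Properties using (∈-resp-↭; ↭-length; shift; shifts; ++-assoc; ++-identityʳ; ++⁺ˡ; ++⁺ʳ; ++-commutativeMonoid)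
open import Function.Definitions using (Injective)
open import Function.Bundles using (mk⇔)
open import Relation.Nullary.Decidable using (Dec; yes; no; does; _⊎-dec_; dec-true; dec-false; does-⇔)
open import Relation.Binary.PropositionalEquality as ≡ using (_≡_; _≢_; refl; cong; cong₂; subst)
import Algebra.Solver.CommutativeMonoid as MonoidSolver
import Data.List.Relation.Binary.Permutation.Setoid.Properties as SetoidPerm

-- Repetition-free lists and permutations.

private variable
  A : Set

Unique-resp-↭ : {xs ys : List A} → xs ↭ ys → Unique xs → Unique ys
Unique-resp-↭ {A} p = SetoidPerm.Unique-resp-↭ (≡.setoid A) (↭⇒↭ₛ p)

Unique-++⁻ʳ : (xs : List A) {ys : List A} → Unique (xs ++ ys) → Unique ys
Unique-++⁻ʳ []       u       = u
Unique-++⁻ʳ (x ∷ xs) (_ ∷ u) = Unique-++⁻ʳ xs u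

∈⇒↭∷ : {x : A} {xs : List A} → x ∈ xs → ∃ λ ys → xs ↭ x ∷ ys
∈⇒↭∷ x∈ with ys , zs , refl ← ∈-∃++ x∈ = ys ++ zs , shift _ ys zs

-- Vertex lists standing for induced subgraphs: degrees and edge counts.

module Dissociation {V : Set} (adj : V → V → Bool)
  (adj-sym : ∀ x y → adj x y ≡ adj y x) (adj-irrefl : ∀ x → adj x x ≡ false) where

  private
    variable
      v x y z : V
      C D K S T U Y : List V
      Ks : List (List V)

    module P = MonoidSolver (++-commutativeMonoid {A = V})
    open P using (_⊕_; _⊜_)

  infix 4 _~_

  _~_ : V → V → Set
  x ~ y = adj x y ≡ true

  ~-sym : x ~ y → y ~ x
  ~-sym {x} {y} p = ≡.trans (adj-sym y x) p

  ¬~ : adj x y ≡ false → x ~ y → ⊥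
  ¬~ p q with () ← ≡.trans (≡.sym p) q

  ⟦_⟧ : Bool → ℕ
  ⟦ false ⟧ = 0
  ⟦ true  ⟧ = 1

  deg : V → List V → ℕ
  deg x []       = 0
  deg x (y ∷ ys) = ⟦ adj x y ⟧ + deg x ys

  edges : List V → ℕ
  edges []       = 0
  edges (x ∷ xs) = deg x xs + edges xs

  deg-++ : ∀ x S → deg x (S ++ T) ≡ deg x S + deg x T
  deg-++ x []      = refl
  deg-++ x (y ∷ S) = ≡.trans (cong (⟦ adj x y ⟧ +_) (deg-++ x S)) (≡.sym (+-assoc ⟦ adj x y ⟧ _ _))

  deg-↭ : ∀ x → S ↭ T → deg x S ≡ deg x T
  deg-↭ x refl        = refl
  deg-↭ x (prep y p)  = cong (⟦ adj x y ⟧ +_) (deg-↭ x p)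
  deg-↭ x (swap y z p) rewrite deg-↭ x p = lem ⟦ adj x y ⟧ ⟦ adj x z ⟧ _
    where
    lem : ∀ a b c → a + (b + c) ≡ b + (a + c)
    lem = solve-∀
  deg-↭ x (trans p q) = ≡.trans (deg-↭ x p) (deg-↭ x q)

  edges-↭ : S ↭ T → edges S ≡ edges T
  edges-↭ refl         = refl
  edges-↭ (prep x p)   = cong₂ _+_ (deg-↭ x p) (edges-↭ p)
  edges-↭ (swap {ys = T} x y p)
    rewrite deg-↭ x p | deg-↭ y p | edges-↭ p | adj-sym x y = lem ⟦ adj y x ⟧ (deg x T) (deg y T) (edges T)
    where
    lem : ∀ a b c d → (a + b) + (c + d) ≡ (a + c) + (b + d)
    lem = solve-∀
  edges-↭ (trans p q)  = ≡.trans (edges-↭ p) (edges-↭ q)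

  -- The edges between `S` and `T` are dropped. A lower bound on the edge count is all that the
  -- weight estimates ask for.
  edges-++ : ∀ S T → edges S + edges T ≤ edges (S ++ T)
  edges-++ []      T = ≤-refl
  edges-++ (x ∷ S) T = begin
    (deg x S + edges S) + edges T ≡⟨ +-assoc (deg x S) _ _ ⟩
    deg x S + (edges S + edges T) ≤⟨ +-mono-≤ (m≤m+n (deg x S) (deg x T)) (edges-++ S T) ⟩
    (deg x S + deg x T) + edges (S ++ T) ≡⟨ cong (_+ edges (S ++ T)) (deg-++ x S) ⟨
    deg x (S ++ T) + edges (S ++ T) ∎
    where open ≤-Reasoning

  deg-pos : y ∈ T → x ~ y → 1 ≤ deg x T
  deg-pos (here refl) p rewrite p = s≤s z≤n
  deg-pos {T = z ∷ T} (there i) p = ≤-trans (deg-pos i p) (m≤n+m _ _)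

  deg-pos⁻ : ∀ T → 1 ≤ deg x T → ∃ λ y → y ∈ T × x ~ y
  deg-pos⁻ {x} (y ∷ T) d with adj x y in eq
  ... | true = y , here refl , eq
  ... | false with z , i , p ← deg-pos⁻ T d = z , there i , p

  deg-zero : (∀ {y} → y ∈ T → adj x y ≡ false) → deg x T ≡ 0
  deg-zero {[]}    f = refl
  deg-zero {y ∷ T} f rewrite f (here refl) = deg-zero (λ i → f (there i))

  deg-zero⁻ : deg x T ≡ 0 → y ∈ T → adj x y ≡ false
  deg-zero⁻ {x} {T = z ∷ T} d (here refl) with adj x z
  ... | false = refl
  deg-zero⁻ {x} {T = z ∷ T} d (there i) = deg-zero⁻ (m+n≡0⇒n≡0 ⟦ adj x z ⟧ d) i

  NoEdge : List V → List V → Set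
  NoEdge S T = ∀ {x y} → x ∈ S → y ∈ T → adj x y ≡ false

  noEdge-sym : NoEdge S T → NoEdge T S
  noEdge-sym n i j = ≡.trans (adj-sym _ _) (n j i)

  noEdge-++ʳ : ∀ T → NoEdge S T → NoEdge S U → NoEdge S (T ++ U)
  noEdge-++ʳ T n n′ i j with ∈-++⁻ T j
  ... | inj₁ j′ = n i j′
  ... | inj₂ j′ = n′ i j′

  noEdge-++ˡ : ∀ S → NoEdge S U → NoEdge T U → NoEdge (S ++ T) U
  noEdge-++ˡ S n n′ i j with ∈-++⁻ S i
  ... | inj₁ i′ = n i′ j
  ... | inj₂ i′ = n′ i′ j

  deg-noEdge : NoEdge S T → x ∈ S → deg x T ≡ 0
  deg-noEdge n i = deg-zero (n i)

  -- Walks, connectedness and components.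

  data Walk (T : List V) : V → V → Set where
    stop : Walk T x x
    _◂_  : x ~ y × y ∈ T → Walk T y z → Walk T x z

  Conn : List V → Set
  Conn T = ∀ {x y} → x ∈ T → y ∈ T → Walk T x y

  walk-⊆ : (∀ {x} → x ∈ S → x ∈ T) → Walk S x y → Walk T x y
  walk-⊆ f stop          = stop
  walk-⊆ f ((p , i) ◂ w) = (p , f i) ◂ walk-⊆ f w

  walk-trans : Walk T x y → Walk T y z → Walk T x z
  walk-trans stop    w′ = w′
  walk-trans (s ◂ w) w′ = s ◂ walk-trans w w′

  conn-↭ : S ↭ T → Conn S → Conn T
  conn-↭ p c i j = walk-⊆ (∈-resp-↭ p) (c (∈-resp-↭ (↭-sym p) i) (∈-resp-↭ (↭-sym p) j))

  conn-[] : Conn []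
  conn-[] ()

  conn-[-] : Conn [ x ]
  conn-[-] (here refl) (here refl) = stop

  conn-++ : ∀ S → Conn S → Conn T → x ∈ S → y ∈ T → x ~ y → Conn (S ++ T)
  conn-++ S cS cT x∈ y∈ x~y i j with ∈-++⁻ S i | ∈-++⁻ S j
  ... | inj₁ i | inj₁ j = walk-⊆ ∈-++⁺ˡ (cS i j)
  ... | inj₂ i | inj₂ j = walk-⊆ (∈-++⁺ʳ S) (cT i j)
  ... | inj₁ i | inj₂ j = walk-trans (walk-⊆ ∈-++⁺ˡ (cS i x∈))
                            ((x~y , ∈-++⁺ʳ S y∈) ◂ walk-⊆ (∈-++⁺ʳ S) (cT y∈ j))
  ... | inj₂ i | inj₁ j = walk-trans (walk-⊆ (∈-++⁺ʳ S) (cT i y∈))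
                            ((~-sym x~y , ∈-++⁺ˡ x∈) ◂ walk-⊆ ∈-++⁺ˡ (cS x∈ j))

  data Components : List (List V) → Set where
    []  : Components []
    add : x ∈ K → Conn K → NoEdge K (concat Ks) → Components Ks → Components (K ∷ Ks)

  record Absorbed (u : V) (Ks : List (List V)) : Set where
    field
      part    : List V
      rest    : List (List V)
      u∈part  : u ∈ part
      perm    : u ∷ concat Ks ↭ part ++ concat rest
      conn    : Conn part
      noEdge  : NoEdge part (concat rest)
      comps   : Components rest
      rest⊆   : ∀ {x} → x ∈ concat rest → x ∈ concat Ks

  -- The blocks with a neighbour of `u` merge with `u` into one connected part; the others stay. The
  -- field `rest⊆` transfers the absence of edges from the old blocks to the remaining ones.
  absorb : ∀ u → Components Ks → Absorbed u Ks
  absorb u [] = record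
    { part = [ u ] ; rest = [] ; u∈part = here refl ; perm = ↭-refl ; conn = conn-[-]
    ; noEdge = λ _ () ; comps = [] ; rest⊆ = λ () }
  absorb u (add {K = K} {Ks = Ks} x∈ cK nK cs) with absorb u cs
  ... | r with deg u K in eq
  ...   | zero = record
    { part = part ; rest = K ∷ rest ; u∈part = u∈part
    ; perm = ↭-trans (shifts [ u ] K)
               (↭-trans (++⁺ˡ K perm) (shifts K part))
    ; conn = conn
    ; noEdge = noEdge-++ʳ K part-K noEdge
    ; comps = add x∈ cK (λ i j → nK i (rest⊆ j)) comps
    ; rest⊆ = λ i → lem (∈-++⁻ K i) }
    where
    open Absorbed r
    lem : x ∈ K ⊎ x ∈ concat rest → x ∈ K ++ concat Ks
    lem (inj₁ i) = ∈-++⁺ˡ i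
    lem (inj₂ i) = ∈-++⁺ʳ K (rest⊆ i)
    part-K : NoEdge part K
    part-K i j with ∈-resp-↭ (↭-sym perm) (∈-++⁺ˡ i)
    ... | here refl = deg-zero⁻ eq j
    ... | there i′  = noEdge-sym nK i′ j
  ...   | suc d with y , y∈ , u~y ← deg-pos⁻ {x = u} K (subst (1 ≤_) (≡.sym eq) (s≤s z≤n)) = record
    { part = K ++ part ; rest = rest ; u∈part = ∈-++⁺ʳ K u∈part
    ; perm = ↭-trans (shifts [ u ] K)
               (↭-trans (++⁺ˡ K perm) (↭-sym (++-assoc K part (concat rest))))
    ; conn = conn-++ K cK conn y∈ u∈part (~-sym u~y)
    ; noEdge = noEdge-++ˡ K (λ i j → nK i (rest⊆ j)) noEdge
    ; comps = comps
    ; rest⊆ = λ i → ∈-++⁺ʳ K (rest⊆ i) }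
    where open Absorbed r

  components : ∀ U → ∃ λ Ks → U ↭ concat Ks × Components Ks
  components []      = [] , ↭-refl , []
  components (u ∷ U) with components U
  ... | Ks , p , cs = part ∷ rest , ↭-trans (prep u p) perm , add u∈part conn noEdge comps
    where open Absorbed (absorb u cs)

  Touches : V → List V → Set
  Touches v K = ∃ λ k → k ∈ K × v ~ k

  -- A walk from a component to `v` cannot pass directly into another component, so it must leave
  -- through `v`, and the last vertex before that is a neighbour of `v`. `D` collects the components
  -- already treated.
  components-touch : ∀ D → v ∉ U → Conn (v ∷ U) → Components Ks → NoEdge (concat Ks) D →
    (∀ {x} → x ∈ concat Ks → x ∈ U) → (∀ {x} → x ∈ U → x ∈ D ++ concat Ks) → All (Touches v) Ks
  components-touch D v∉ c [] n f g = []
  components-touch {v} {U} D v∉ c (add {K = K} {Ks = Ks} x∈ cK nK cs) n f g =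
    exit x∈ (c (there (f (∈-++⁺ˡ x∈))) (here refl))
    ∷ components-touch (D ++ K) v∉ c cs
        (noEdge-++ʳ D (λ i → n (∈-++⁺ʳ K i)) (noEdge-sym nK)) (λ i → f (∈-++⁺ʳ K i))
        (λ i → ∈-resp-↭ (↭-sym (++-assoc D K (concat Ks))) (g i))
    where
    exit : x ∈ K → Walk (v ∷ U) x v → Touches v K
    exit i stop = ⊥-elim (v∉ (f (∈-++⁺ˡ i)))
    exit {x} i ((x~y , here refl) ◂ w) = x , i , ~-sym x~y
    exit i ((x~y , there j) ◂ w) with ∈-++⁻ D (g j)
    ... | inj₁ j′ = ⊥-elim (¬~ (n (∈-++⁺ˡ i) j′) x~y)
    ... | inj₂ j′ with ∈-++⁻ K j′
    ...   | inj₁ k = exit k w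
    ...   | inj₂ k = ⊥-elim (¬~ (nK i k) x~y)

  conn-concat : All (Touches v) Ks → Components Ks → v ∈ T → Conn T → Conn (concat Ks ++ T)
  conn-concat [] [] v∈ c = c
  conn-concat {v} {T = T} ((k , k∈ , v~k) ∷ ts) (add {K = K} {Ks = Ks} _ cK _ cs) v∈ c =
    conn-↭ (↭-sym (++-assoc K (concat Ks) T))
      (conn-++ K cK (conn-concat ts cs v∈ c) k∈ (∈-++⁺ʳ (concat Ks) v∈) (~-sym v~k))

  -- Vertex covers of the three-vertex paths, and the weight inequality.

  PathCover : List V → List V → Set
  PathCover X C = ∀ {x y z} → x ∈ X → y ∈ X → z ∈ X → x ∉ C → y ∉ C → z ∉ C → x ~ y → x ~ z → y ≡ z

  cover-↭ : S ↭ T → PathCover S C → PathCover T C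
  cover-↭ p c i j k = c (∈-resp-↭ (↭-sym p) i) (∈-resp-↭ (↭-sym p) j) (∈-resp-↭ (↭-sym p) k)

  cover-∷ : PathCover S C → PathCover (v ∷ S) (v ∷ C)
  cover-∷ c (here p) _ _ n _ _ = ⊥-elim (n (here p))
  cover-∷ c (there _) (here p) _ _ n _ = ⊥-elim (n (here p))
  cover-∷ c (there _) (there _) (here p) _ _ n = ⊥-elim (n (here p))
  cover-∷ c (there i) (there j) (there k) n n′ n″ = c i j k (λ m → n (there m)) (λ m → n′ (there m)) (λ m → n″ (there m))

  -- Two edges with a common end lie on the same side, since no edge crosses.
  cover-++ : ∀ S → NoEdge S T → PathCover S C → PathCover T D → PathCover (S ++ T) (C ++ D)
  cover-++ {C = C} S n c d {x} {y} {z} i j k a b e p q with ∈-++⁻ S i | ∈-++⁻ S j | ∈-++⁻ S k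
  ... | inj₁ i | inj₁ j | inj₁ k = c i j k (λ m → a (∈-++⁺ˡ m)) (λ m → b (∈-++⁺ˡ m)) (λ m → e (∈-++⁺ˡ m)) p q
  ... | inj₂ i | inj₂ j | inj₂ k = d i j k (λ m → a (∈-++⁺ʳ C m)) (λ m → b (∈-++⁺ʳ C m)) (λ m → e (∈-++⁺ʳ C m)) p q
  ... | inj₁ i | inj₂ j | _      = ⊥-elim (¬~ (n i j) p)
  ... | inj₁ i | inj₁ j | inj₂ k = ⊥-elim (¬~ (n i k) q)
  ... | inj₂ i | inj₁ j | _      = ⊥-elim (¬~ (n j i) (~-sym p))
  ... | inj₂ i | inj₂ j | inj₁ k = ⊥-elim (¬~ (n k i) (~-sym q))

  cover-pair : PathCover (x ∷ y ∷ []) []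
  cover-pair (here refl) (here refl) _ _ _ _ p q = ⊥-elim (¬~ (adj-irrefl _) p)
  cover-pair (here refl) (there (here refl)) (here refl) _ _ _ p q = ⊥-elim (¬~ (adj-irrefl _) q)
  cover-pair (here refl) (there (here refl)) (there (here refl)) _ _ _ p q = refl
  cover-pair (there (here refl)) (there (here refl)) _ _ _ _ p q = ⊥-elim (¬~ (adj-irrefl _) p)
  cover-pair (there (here refl)) (here refl) (there (here refl)) _ _ _ p q = ⊥-elim (¬~ (adj-irrefl _) q)
  cover-pair (there (here refl)) (here refl) (here refl) _ _ _ p q = refl

  cover-single : PathCover [ x ] []
  cover-single (here refl) (here refl) _ _ _ _ p q = ⊥-elim (¬~ (adj-irrefl _) p)

  -- The weight inequality: a chosen vertex costs 5 and an edge pays 2. The extra 2 is passed on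
  -- unchanged by the induction and spent only at the root of the search.
  Good : List V → Set
  Good X = ∃ λ C → PathCover X C × 5 * length C ≤ 2 * edges X + 2

  -- A component K of G − v − Y.  Its excess bounds from below what the edges deleted in v ∷ K, weighted 2,
  -- leave after paying 5 per chosen vertex of K; deleting v is affordable once the excesses and
  -- 2 deg v Y add up to 5.
  data Child (v : V) (Y K : List V) : Set where
    leaf  : ∀ a → K ↭ [ a ] → v ~ a → deg a Y ≡ 0 → Child v Y K
    heavy : ∀ C → PathCover K C → NoEdge K Y → 5 * length C + 3 ≤ 2 * (deg v K + edges K) → Child v Y K
    open₁ : ∀ a → K ↭ [ a ] → v ~ a → deg a Y ≡ 1 → Child v Y K
    open₂ : ∀ a b → K ↭ a ∷ b ∷ [] → v ~ a → a ~ b → deg a Y ≡ 0 → deg b Y ≡ 1 → Child v Y K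
    open₃ : ∀ a b c → K ↭ a ∷ b ∷ c ∷ [] → v ~ a → a ~ b → b ~ c →
            deg a Y ≡ 0 → deg b Y ≡ 0 → deg c Y ≡ 1 → Child v Y K

  -- The extra unit of a `heavy` child is what lets `v` be deleted when it has just this child and
  -- one edge to `Y`: 3 + 2 = 5.
  excess : Child v Y K → ℕ
  excess (heavy _ _ _ _) = 3
  excess _               = 2

  excess≥2 : (c : Child v Y K) → 2 ≤ excess c
  excess≥2 (leaf _ _ _ _)            = ≤-refl
  excess≥2 (heavy _ _ _ _)           = s≤s (s≤s z≤n)
  excess≥2 (open₁ _ _ _ _)           = ≤-refl
  excess≥2 (open₂ _ _ _ _ _ _ _)     = ≤-refl
  excess≥2 (open₃ _ _ _ _ _ _ _ _ _ _) = ≤-refl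

  total : All (Child v Y) Ks → ℕ
  total []       = 0
  total (c ∷ cs) = excess c + total cs

  -- Deleting `v`: components that go with it and components that stay.

  Closed : V → List V → List V → ℕ → Set
  Closed v Y K x = ∃ λ C → PathCover K C × NoEdge K Y × 5 * length C + x ≤ 2 * (deg v K + edges K)

  -- Such a `K` survives the deletion of `v`, attached to `Y`, so only the edges between `v` and `K`
  -- may be counted.
  Open : V → List V → List V → ℕ → Set
  Open v Y K x = x ≤ 2 * deg v K × ∃ λ k → k ∈ K × 1 ≤ deg k Y

  noEdge-deg : (∀ {x} → x ∈ S → deg x Y ≡ 0) → NoEdge S Y
  noEdge-deg f i j = deg-zero⁻ (f i) j

  noEdge-↭ˡ : S ↭ T → NoEdge T Y → NoEdge S Y
  noEdge-↭ˡ p n i j = n (∈-resp-↭ p i) j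

  -- A `leaf` pays with its edge to `v` and needs no chosen vertex. The three open kinds are joined
  -- to `Y` at their last vertex and pay with the edge from `v` to their first.
  closed⊎open : (c : Child v Y K) → Closed v Y K (excess c) ⊎ Open v Y K (excess c)
  closed⊎open {v} {K = K} (leaf a p v~a d) = inj₁
    ( [] , cover-↭ (↭-sym p) cover-single
    , noEdge-↭ˡ p (noEdge-deg λ { (here refl) → d })
    , *-monoʳ-≤ 2 (≤-trans (deg-pos (∈-resp-↭ (↭-sym p) (here refl)) v~a) (m≤m+n (deg v K) (edges K))))
  closed⊎open (heavy C c n h) = inj₁ (C , c , n , h)
  closed⊎open (open₁ a p v~a d) = inj₂
    ( *-monoʳ-≤ 2 (deg-pos (∈-resp-↭ (↭-sym p) (here refl)) v~a)
    , a , ∈-resp-↭ (↭-sym p) (here refl) , ≤-reflexive (≡.sym d))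
  closed⊎open (open₂ a b p v~a _ _ d) = inj₂
    ( *-monoʳ-≤ 2 (deg-pos (∈-resp-↭ (↭-sym p) (here refl)) v~a)
    , b , ∈-resp-↭ (↭-sym p) (there (here refl)) , ≤-reflexive (≡.sym d))
  closed⊎open (open₃ a b c p v~a _ _ _ _ d) = inj₂
    ( *-monoʳ-≤ 2 (deg-pos (∈-resp-↭ (↭-sym p) (here refl)) v~a)
    , c , ∈-resp-↭ (↭-sym p) (there (there (here refl))) , ≤-reflexive (≡.sym d))

  record Split (v : V) (Y U : List V) (x : ℕ) : Set where
    field
      gone kept chosen : List V
      perm    : U ↭ gone ++ kept
      noEdge  : NoEdge gone (kept ++ Y)
      cover   : PathCover gone chosen
      conn    : Conn (kept ++ Y)
      -- at the root of the search nothing is left over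
      root    : Y ≡ [] → kept ≡ []
      bound   : 5 * length chosen + x ≤ 2 * (deg v gone + edges gone + deg v kept)

  -- Closed components go into `gone` along with their covers. Open ones go into `kept`, which
  -- remains connected together with `Y` because each has an edge into `Y`. The excesses add up
  -- since distinct components account for distinct edges.
  split : Components Ks → (cs : All (Child v Y) Ks) → Conn Y → Split v Y (concat Ks) (total cs)
  split [] [] c = record
    { gone = [] ; kept = [] ; chosen = [] ; perm = ↭-refl ; noEdge = λ () ; cover = λ () ; conn = c
    ; root = λ _ → refl ; bound = z≤n }
  split {v = v} {Y = Y} (add {K = K} {Ks = Ks} _ cK nK comps) (ch ∷ chs) c with split comps chs c | closed⊎open ch
  ... | r | inj₁ (C′ , cov , nY , h) = record
    { gone = K ++ gone ; kept = kept ; chosen = C′ ++ chosen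
    ; perm = ↭-trans (++⁺ˡ K perm) (↭-sym (++-assoc K gone kept))
    ; noEdge = noEdge-++ˡ K (noEdge-++ʳ kept (λ i j → nK i (∈-resp-↭ (↭-sym perm) (∈-++⁺ʳ gone j))) nY) noEdge
    ; cover = cover-++ K (λ i j → nK i (∈-resp-↭ (↭-sym perm) (∈-++⁺ˡ j))) cov cover
    ; conn = conn ; root = root
    ; bound = lem }
    where
    open Split r
    eq₁ : ∀ a b x y → 5 * (a + b) + (x + y) ≡ (5 * a + x) + (5 * b + y)
    eq₁ = solve-∀
    eq₂ : ∀ a b c d e → 2 * (a + b) + 2 * (c + d + e) ≡ 2 * ((a + c) + (b + d) + e)
    eq₂ = solve-∀
    open ≤-Reasoning
    lem : 5 * length (C′ ++ chosen) + (excess ch + total chs) ≤ 2 * (deg v (K ++ gone) + edges (K ++ gone) + deg v kept)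
    lem = begin
      5 * length (C′ ++ chosen) + (excess ch + total chs) ≡⟨ cong (λ l → 5 * l + (excess ch + total chs)) (length-++ C′) ⟩
      5 * (length C′ + length chosen) + (excess ch + total chs) ≡⟨ eq₁ (length C′) (length chosen) _ _ ⟩
      (5 * length C′ + excess ch) + (5 * length chosen + total chs) ≤⟨ +-mono-≤ h bound ⟩
      2 * (deg v K + edges K) + 2 * (deg v gone + edges gone + deg v kept) ≡⟨ eq₂ (deg v K) (edges K) (deg v gone) (edges gone) (deg v kept) ⟩
      2 * ((deg v K + deg v gone) + (edges K + edges gone) + deg v kept)
        ≤⟨ *-monoʳ-≤ 2 (+-mono-≤ (+-mono-≤ (≤-reflexive (≡.sym (deg-++ v K))) (edges-++ K gone)) ≤-refl) ⟩
      2 * (deg v (K ++ gone) + edges (K ++ gone) + deg v kept) ∎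
  ... | r | inj₂ (h , k , k∈ , d) with y , y∈ , k~y ← deg-pos⁻ {x = k} Y d = record
    { gone = gone ; kept = K ++ kept ; chosen = chosen
    ; perm = ↭-trans (++⁺ˡ K perm) (shifts K gone)
    ; noEdge = λ i j → lem₁ i (∈-resp-↭ (++-assoc K kept Y) j)
    ; cover = cover
    ; conn = conn-↭ (↭-sym (++-assoc K kept Y))
        (conn-++ K cK conn k∈ (∈-++⁺ʳ kept y∈) k~y)
    -- An open component has a neighbour in `Y`, so `Y` cannot be empty here.
    ; root = λ { refl → ⊥-elim (¬[] y∈) }
    ; bound = lem₂ }
    where
    open Split r
    ¬[] : ∀ {x : V} → x ∈ [] → ⊥
    ¬[] ()
    lem₁ : NoEdge gone (K ++ (kept ++ Y))
    lem₁ = noEdge-++ʳ K (λ i j → noEdge-sym nK (∈-resp-↭ (↭-sym perm) (∈-++⁺ˡ i)) j) noEdge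
    eq₁ : ∀ a x y → a + (x + y) ≡ x + (a + y)
    eq₁ = solve-∀
    eq₂ : ∀ a b c d → 2 * a + 2 * (b + c + d) ≡ 2 * (b + c + (a + d))
    eq₂ = solve-∀
    open ≤-Reasoning
    lem₂ : 5 * length chosen + (excess ch + total chs) ≤ 2 * (deg v gone + edges gone + deg v (K ++ kept))
    lem₂ = begin
      5 * length chosen + (excess ch + total chs) ≡⟨ eq₁ (5 * length chosen) (excess ch) (total chs) ⟩
      excess ch + (5 * length chosen + total chs) ≤⟨ +-mono-≤ h bound ⟩
      2 * deg v K + 2 * (deg v gone + edges gone + deg v kept) ≡⟨ eq₂ (deg v K) (deg v gone) (edges gone) (deg v kept) ⟩
      2 * (deg v gone + edges gone + (deg v K + deg v kept)) ≡⟨ cong (λ l → 2 * (deg v gone + edges gone + l)) (deg-++ v K) ⟨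
      2 * (deg v gone + edges gone + deg v (K ++ kept)) ∎

  -- The connected parts v ∷ U of G − Y that cannot be reduced: paths starting at v, joined to Y at v only
  -- (pend) or at both ends (arc).
  data Shape (v : V) (U Y : List V) : Set where
    pend₁ : U ↭ [] → deg v Y ≡ 1 → Shape v U Y
    pend₂ : ∀ b → U ↭ [ b ] → v ~ b → deg v Y ≡ 1 → deg b Y ≡ 0 → Shape v U Y
    arc₁  : U ↭ [] → deg v Y ≡ 2 → Shape v U Y
    arc₂  : ∀ b → U ↭ [ b ] → v ~ b → deg v Y ≡ 1 → deg b Y ≡ 1 → Shape v U Y
    arc₃  : ∀ b c → U ↭ b ∷ c ∷ [] → v ~ b → b ~ c →
            deg v Y ≡ 1 → deg b Y ≡ 0 → deg c Y ≡ 1 → Shape v U Y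

  -- The shape of `K` was found relative to everything outside `K`. As `K` has no edge to the other
  -- components `R`, the outside degree of a vertex is its degree into `Y`, plus one if it is
  -- adjacent to `v`. The end `a` spends one unit on `v`; what matters is whether the other end does
  -- too.
  toChild : ∀ {R a U} → K ↭ a ∷ U → v ~ a → NoEdge K R → Shape a U (v ∷ R ++ Y) → Child v Y K
  toChild {K} {v} {Y} {R} {a} {U} p v~a n sh = go sh
    where
    deg-split : ∀ {x} → x ∈ K → deg x (v ∷ R ++ Y) ≡ ⟦ adj x v ⟧ + deg x Y
    deg-split {x} i = cong (⟦ adj x v ⟧ +_) (≡.trans (deg-++ x R) (cong (_+ deg x Y) (deg-noEdge n i)))

    deg-adj : ∀ {x k} → x ∈ K → x ~ v → deg x (v ∷ R ++ Y) ≡ suc k → deg x Y ≡ k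
    deg-adj {x} i x~v d = suc-injective (≡.trans (cong (λ b → ⟦ b ⟧ + deg x Y) (≡.sym x~v)) (≡.trans (≡.sym (deg-split i)) d))

    deg-nonadj : ∀ {x k} → x ∈ K → adj x v ≡ false → deg x (v ∷ R ++ Y) ≡ k → deg x Y ≡ k
    deg-nonadj {x} i x≁v d = ≡.trans (cong (λ b → ⟦ b ⟧ + deg x Y) (≡.sym x≁v)) (≡.trans (≡.sym (deg-split i)) d)

    deg-none : ∀ {x} → x ∈ K → deg x (v ∷ R ++ Y) ≡ 0 → deg x Y ≡ 0
    deg-none {x} i d = m+n≡0⇒n≡0 ⟦ adj x v ⟧ (≡.trans (≡.sym (deg-split i)) d)

    a∈ : a ∈ K
    a∈ = ∈-resp-↭ (↭-sym p) (here refl)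

    heavy-pair : ∀ b → K ↭ a ∷ b ∷ [] → a ~ b → deg a Y ≡ 0 → deg b Y ≡ 0 → Child v Y K
    heavy-pair b q a~b da db = heavy [] (cover-↭ (↭-sym q) cover-pair)
      (noEdge-↭ˡ q (noEdge-deg λ { (here refl) → da ; (there (here refl)) → db }))
      lem
      where
      three : ∀ t → 3 + (1 + 2 * t) ≡ 2 * ((1 + (t + 0)) + ((1 + 0) + (0 + 0)))
      three = solve-∀
      lem : 3 ≤ 2 * (deg v K + edges K)
      -- The two edges `v ~ a` and `a ~ b` already weigh 4; a chord only adds to this.
      lem rewrite deg-↭ v q | edges-↭ q | v~a | a~b = ≤-trans (m≤m+n 3 _) (≤-reflexive (three ⟦ adj v b ⟧))

    heavy-triple : ∀ b c → K ↭ a ∷ b ∷ c ∷ [] → a ~ b → b ~ c → v ~ c →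
      deg a Y ≡ 0 → deg b Y ≡ 0 → deg c Y ≡ 0 → Child v Y K
    heavy-triple b c q a~b b~c v~c da db dc = heavy [ a ] (cover-↭ (↭-sym q) (cover-∷ cover-pair))
      (noEdge-↭ˡ q (noEdge-deg λ { (here refl) → da ; (there (here refl)) → db ; (there (there (here refl))) → dc }))
      lem
      where
      eight : ∀ t u → 8 + (2 * t + 2 * u) ≡ 2 * ((1 + (t + (1 + 0))) + ((1 + (u + 0)) + ((1 + 0) + (0 + 0))))
      eight = solve-∀
      lem : 8 ≤ 2 * (deg v K + edges K)
      -- The four edges of the cycle through `v`, `a`, `b`, `c` weigh 8, which is 5 for the chosen
      -- vertex `a` and an excess of 3. The diagonals only add to this.
      lem rewrite deg-↭ v q | edges-↭ q | v~a | a~b | b~c | v~c =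
        ≤-trans (m≤m+n 8 _) (≤-reflexive (eight ⟦ adj v b ⟧ ⟦ adj a c ⟧))

    go : Shape a U (v ∷ R ++ Y) → Child v Y K
    go (pend₁ q d) = leaf a (↭-trans p (prep a q)) v~a (deg-adj a∈ (~-sym v~a) d)
    go (arc₁ q d) = open₁ a (↭-trans p (prep a q)) v~a (deg-adj a∈ (~-sym v~a) d)
    go (pend₂ b q a~b da db) =
      heavy-pair b pq a~b (deg-adj a∈ (~-sym v~a) da) (deg-none (∈-resp-↭ (↭-sym pq) (there (here refl))) db)
      where
      pq : K ↭ a ∷ b ∷ []
      pq = ↭-trans p (prep a q)
    go (arc₂ b q a~b da db) = lem (adj b v) refl
      where
      pq : K ↭ a ∷ b ∷ []
      pq = ↭-trans p (prep a q)
      b∈ : b ∈ K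
      b∈ = ∈-resp-↭ (↭-sym pq) (there (here refl))
      lem : ∀ t → adj b v ≡ t → Child v Y K
      -- The outside edge of `b` goes to `v` and closes a triangle, so nothing of `K` is joined to
      -- `Y`.
      lem true  b~v = heavy-pair b pq a~b (deg-adj a∈ (~-sym v~a) da) (deg-adj b∈ b~v db)
      lem false b≁v = open₂ a b pq v~a a~b (deg-adj a∈ (~-sym v~a) da) (deg-nonadj b∈ b≁v db)
    go (arc₃ b c q a~b b~c da db dc) = lem (adj c v) refl
      where
      pq : K ↭ a ∷ b ∷ c ∷ []
      pq = ↭-trans p (prep a q)
      b∈ : b ∈ K
      b∈ = ∈-resp-↭ (↭-sym pq) (there (here refl))
      c∈ : c ∈ K
      c∈ = ∈-resp-↭ (↭-sym pq) (there (there (here refl)))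
      lem : ∀ t → adj c v ≡ t → Child v Y K
      -- The outside edge of `c` goes to `v`: this is the component that forms a 4-cycle with `v`.
      lem true  c~v = heavy-triple b c pq a~b b~c (~-sym c~v)
                        (deg-adj a∈ (~-sym v~a) da) (deg-none b∈ db) (deg-adj c∈ c~v dc)
      lem false c≁v = open₃ a b c pq v~a a~b b~c
                        (deg-adj a∈ (~-sym v~a) da) (deg-none b∈ db) (deg-nonadj c∈ c≁v dc)

  -- The inductive step: reducible configurations and the search.

  module Step (X : List V) (X-unique : Unique X)
    (ih : ∀ Z → length Z < length X → Unique Z → Conn Z → Good Z) where

    regroup : ∀ S T → X ↭ v ∷ U ++ Y → U ↭ S ++ T → X ↭ (v ∷ S) ++ (T ++ Y)
    regroup {v} {Y = Y} S T p q = ↭-trans p (prep v (↭-trans (++⁺ʳ Y q)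
      (++-assoc S T Y)))

    -- The induction hypothesis covers `kept ++ Y`; adding `v` and `chosen` covers the rest. The 5
    -- for `v` is paid by the excess `x` and by the edges from `v` to `Y`, each of weight 2.
    remove : ∀ {v U Y x} → X ↭ v ∷ U ++ Y → Split v Y U x → 5 ≤ x + 2 * deg v Y → Good X
    remove {v} {U} {Y} {x} p s h with ih (kept ++ Y) shorter uniqueZ conn
      where
      open Split s
      q : X ↭ (v ∷ gone) ++ (kept ++ Y)
      q = regroup gone kept p perm
      shorter : length (kept ++ Y) < length X
      shorter rewrite ↭-length q | length-++ gone {kept ++ Y} = s≤s (m≤n+m _ _)
      uniqueZ : Unique (kept ++ Y)
      uniqueZ = Unique-++⁻ʳ (v ∷ gone) (Unique-resp-↭ q X-unique)
    ... | D , cov , b = v ∷ chosen ++ D , cover-↭ (↭-sym q) (cover-∷ (cover-++ gone noEdge cover cov)) , lem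
      where
      open Split s
      q : X ↭ (v ∷ gone) ++ (kept ++ Y)
      q = regroup gone kept p perm
      dG = deg v gone
      dK = deg v kept
      dY = deg v Y
      eG = edges gone
      eZ = edges (kept ++ Y)
      edges-X : edges X ≡ (dG + (dK + dY)) + edges (gone ++ (kept ++ Y))
      edges-X rewrite edges-↭ q | deg-++ {T = kept ++ Y} v gone | deg-++ {T = Y} v kept = refl
      eq₁ : ∀ c d x → 5 * suc (c + d) + x ≡ 5 + ((5 * c + x) + 5 * d)
      eq₁ = solve-∀
      eq₂ : ∀ x y g e k z → (x + 2 * y) + (2 * (g + e + k) + (2 * z + 2)) ≡ 2 * ((g + (k + y)) + (e + z)) + 2 + x
      eq₂ = solve-∀
      open ≤-Reasoning
      lem : 5 * length (v ∷ chosen ++ D) ≤ 2 * edges X + 2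
      -- Adding `x` to both sides lets `bound` be used without subtraction.
      lem = +-cancelʳ-≤ x _ _ (begin
        5 * suc (length (chosen ++ D)) + x ≡⟨ cong (λ l → 5 * suc l + x) (length-++ chosen) ⟩
        5 * suc (length chosen + length D) + x ≡⟨ eq₁ (length chosen) (length D) x ⟩
        5 + ((5 * length chosen + x) + 5 * length D) ≤⟨ +-mono-≤ h (+-mono-≤ bound b) ⟩
        (x + 2 * dY) + (2 * (dG + eG + dK) + (2 * eZ + 2)) ≡⟨ eq₂ x dY dG eG dK eZ ⟩
        2 * ((dG + (dK + dY)) + (eG + eZ)) + 2 + x
          ≤⟨ +-mono-≤ (+-mono-≤ (*-monoʳ-≤ 2 (+-monoʳ-≤ (dG + (dK + dY)) (edges-++ gone (kept ++ Y)))) ≤-refl) ≤-refl ⟩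
        2 * ((dG + (dK + dY)) + edges (gone ++ (kept ++ Y))) + 2 + x ≡⟨ cong (λ l → 2 * l + 2 + x) edges-X ⟨
        2 * edges X + 2 + x ∎)

    -- With `Y` empty nothing survives the deletion, so no inductive cover is needed and the 2 in
    -- `Good` is free. It leaves 3 of the cost of `v` to the excess.
    remove-root : ∀ {v U x} → X ↭ v ∷ U ++ [] → Split v [] U x → 3 ≤ x → Good X
    remove-root {v} {U} {x} p s h = v ∷ chosen , cover-↭ (↭-sym q) (cover-∷ cover) , lem
      where
      open Split s
      q : X ↭ v ∷ gone
      q = ↭-trans p (prep v (↭-trans (++-identityʳ U)
            (↭-trans (subst (λ k → U ↭ gone ++ k) (root refl) perm) (++-identityʳ gone))))
      eq₁ : ∀ c x → 5 * suc c + x ≡ (5 * c + x) + (2 + 3)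
      eq₁ = solve-∀
      eq₂ : ∀ a b x → 2 * (a + b + 0) + (2 + x) ≡ 2 * (a + b) + 2 + x
      eq₂ = solve-∀
      open ≤-Reasoning
      lem : 5 * length (v ∷ chosen) ≤ 2 * edges X + 2
      lem = +-cancelʳ-≤ x _ _ (begin
        5 * suc (length chosen) + x ≡⟨ eq₁ (length chosen) x ⟩
        (5 * length chosen + x) + (2 + 3) ≤⟨ +-mono-≤ bound (+-monoʳ-≤ 2 h) ⟩
        2 * (deg v gone + edges gone + deg v kept) + (2 + x)
          ≡⟨ cong (λ k → 2 * (deg v gone + edges gone + deg v k) + (2 + x)) (root refl) ⟩
        2 * (deg v gone + edges gone + 0) + (2 + x) ≡⟨ eq₂ (deg v gone) (edges gone) x ⟩
        2 * (deg v gone + edges gone) + 2 + x ≡⟨ cong (λ l → 2 * l + 2 + x) (edges-↭ q) ⟨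
        2 * edges X + 2 + x ∎)

    -- Choosing the ends `v` and `c` costs 10. Three path edges and one edge from each end to `Y`
    -- disappear and weigh 10, while `a` and `b` remain as an isolated edge.
    remove-path : ∀ {v a b c Y} → X ↭ v ∷ a ∷ b ∷ c ∷ Y → Conn Y → v ~ a → a ~ b → b ~ c →
      deg v Y ≡ 1 → deg a Y ≡ 0 → deg b Y ≡ 0 → deg c Y ≡ 1 → Good X
    remove-path {v} {a} {b} {c} {Y} p cY v~a a~b b~c dv da db dc
      with ih Y (subst (length Y <_) (≡.sym (↭-length p)) (s≤s (m≤n+m _ 3)))
             (Unique-++⁻ʳ (v ∷ a ∷ b ∷ c ∷ []) (Unique-resp-↭ p X-unique)) cY
    ... | D , cov , h = v ∷ c ∷ D
        , cover-↭ (↭-sym (↭-trans p (prep v (P.solve 4 (λ a b c y → (a ⊕ (b ⊕ (c ⊕ y))) ⊜ (c ⊕ ((a ⊕ b) ⊕ y))) ↭-refl [ a ] [ b ] [ c ] Y))))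
            (cover-∷ (cover-∷ (cover-++ (a ∷ b ∷ [])
              (noEdge-deg λ { (here refl) → da ; (there (here refl)) → db }) cover-pair cov)))
        , lem
      where
      eq₁ : ∀ d → 5 * suc (suc d) ≡ 10 + 5 * d
      eq₁ = solve-∀
      eq₂ : ∀ t u w e → 10 + (2 * e + 2) + 2 * (t + u + w) ≡
        2 * ((1 + (t + (u + 1))) + ((1 + (w + 0)) + ((1 + 0) + (1 + e)))) + 2
      eq₂ = solve-∀
      open ≤-Reasoning
      e = edges Y
      r = ⟦ adj v b ⟧ + ⟦ adj v c ⟧ + ⟦ adj a c ⟧
      edges-X : edges X ≡ (1 + (⟦ adj v b ⟧ + (⟦ adj v c ⟧ + 1))) + ((1 + (⟦ adj a c ⟧ + 0)) + ((1 + 0) + (1 + e)))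
      edges-X rewrite edges-↭ p | v~a | a~b | b~c | dv | da | db | dc = refl
      lem : 5 * length (v ∷ c ∷ D) ≤ 2 * edges X + 2
      lem = begin
        5 * suc (suc (length D)) ≡⟨ eq₁ (length D) ⟩
        10 + 5 * length D ≤⟨ +-monoʳ-≤ 10 h ⟩
        10 + (2 * e + 2) ≤⟨ m≤m+n _ (2 * r) ⟩
        10 + (2 * e + 2) + 2 * r ≡⟨ eq₂ ⟦ adj v b ⟧ ⟦ adj v c ⟧ ⟦ adj a c ⟧ e ⟩
        2 * ((1 + (⟦ adj v b ⟧ + (⟦ adj v c ⟧ + 1))) + ((1 + (⟦ adj a c ⟧ + 0)) + ((1 + 0) + (1 + e)))) + 2 ≡⟨ cong (λ l → 2 * l + 2) edges-X ⟨
        2 * edges X + 2 ∎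

    Children : V → List V → List V → Set
    Children v U Y = ∃ λ Ks → U ↭ concat Ks × Components Ks × All (Child v Y) Ks

    mutual
      -- The case analysis of the search at a vertex `v` other than the root. The bound `k` on the
      -- length of `U` drops at each descent into a component and makes the mutual recursion
      -- terminate.
      analyze : ∀ k {v U Y} → length U ≤ k → X ↭ v ∷ U ++ Y → Conn (v ∷ U) → Conn Y → 1 ≤ deg v Y →
        Good X ⊎ Shape v U Y
      analyze k {v} {U} {Y} l p cT cY d with children k l p cT conn-vY
        where
        conn-vY : Conn (v ∷ Y)
        conn-vY with y , y∈ , v~y ← deg-pos⁻ {x = v} Y d = conn-++ [ v ] conn-[-] cY (here refl) y∈ v~y
      ... | inj₁ g = inj₁ g
      ... | inj₂ (Ks , q , cs , chs) = classify Ks q cs chs (deg v Y) refl d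
        where
        q′ : ∀ Ks → U ↭ concat Ks → X ↭ v ∷ concat Ks ++ Y
        q′ Ks q = ↭-trans p (prep v (++⁺ʳ Y q))
        reduce : ∀ {Ks} → U ↭ concat Ks → Components Ks → (chs : All (Child v Y) Ks) →
          ∀ {s} → deg v Y ≡ s → 5 ≤ total chs + 2 * s → Good X ⊎ Shape v U Y
        reduce {Ks} q cs chs refl h = inj₁ (remove (q′ Ks q) (split cs chs cY) h)
        flat : ∀ {K L} → U ↭ K ++ [] → K ↭ L → U ↭ L
        flat {K} q r = ↭-trans q (↭-trans (++-identityʳ K) r)
        -- Here `s` is the degree of `v` into `Y`. Deletion of `v` is affordable unless there is no
        -- child and `s` is 1 or 2, or there is a single child, not `heavy`, and `s` is 1.
        classify : ∀ Ks → U ↭ concat Ks → Components Ks → (chs : All (Child v Y) Ks) →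
          ∀ s → deg v Y ≡ s → 1 ≤ s → Good X ⊎ Shape v U Y
        classify [] q cs [] 1 e _ = inj₂ (pend₁ q e)
        classify [] q cs [] 2 e _ = inj₂ (arc₁ q e)
        classify [] q cs [] (suc (suc (suc s))) e _ =
          reduce q cs [] e (≤-trans (m≤m+n 5 1) (*-monoʳ-≤ 2 (m≤m+n 3 s)))
        classify (K ∷ Ks) q cs chs@(ch ∷ _) (suc (suc s)) e _ =
          reduce q cs chs e (≤-trans (m≤m+n 5 1)
            (+-mono-≤ (≤-trans (excess≥2 ch) (m≤m+n _ _)) (*-monoʳ-≤ 2 (m≤m+n 2 s))))
        classify (K ∷ _ ∷ Ks) q cs chs@(ch ∷ ch′ ∷ _) (suc s) e _ =
          reduce q cs chs e (≤-trans (m≤m+n 5 1)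
            (+-mono-≤ (+-mono-≤ (excess≥2 ch) (≤-trans (excess≥2 ch′) (m≤m+n _ _))) (*-monoʳ-≤ 2 (m≤m+n 1 s))))
        classify (K ∷ []) q cs (leaf a r v~a da ∷ []) 1 e _ = inj₂ (pend₂ a (flat q r) v~a e da)
        classify (K ∷ []) q cs chs@(heavy _ _ _ _ ∷ []) 1 e _ = reduce q cs chs e ≤-refl
        classify (K ∷ []) q cs (open₁ a r v~a da ∷ []) 1 e _ = inj₂ (arc₂ a (flat q r) v~a e da)
        classify (K ∷ []) q cs (open₂ a b r v~a a~b da db ∷ []) 1 e _ = inj₂ (arc₃ a b (flat q r) v~a a~b e da db)
        -- The weights give only 2 + 2, one short of 5, but `v` extends the child to a four-vertex
        -- path with both ends joined to `Y`.
        classify (K ∷ []) q cs (open₃ a b c r v~a a~b b~c da db dc ∷ []) 1 e _ =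
          inj₁ (remove-path (↭-trans p (prep v (++⁺ʳ Y (flat q r)))) cY v~a a~b b~c e da db dc)

      -- Connectedness is required of `v ∷ Y`, not of `Y` with an edge from `v`, so that the root,
      -- where `Y` is empty, is included.
      children : ∀ k {v U Y} → length U ≤ k → X ↭ v ∷ U ++ Y → Conn (v ∷ U) → Conn (v ∷ Y) →
        Good X ⊎ Children v U Y
      children zero {U = []} l p cT cvY = inj₂ ([] , ↭-refl , [] , [])
      children (suc k) {v} {U} {Y} l p cT cvY with components U
      ... | Ks , q , cs with examine k [] cs touch (λ _ ()) cvY (↭-trans p (prep v (++⁺ʳ Y q)))
                               (≤-trans (≤-reflexive (≡.sym (↭-length q))) l)
        where
        v∉U : v ∉ U
        v∉U i = Unique[x∷xs]⇒x∉xs (Unique-resp-↭ p X-unique) (∈-++⁺ˡ i)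
        touch : All (Touches v) Ks
        touch = components-touch [] v∉U cT cs (λ _ ()) (∈-resp-↭ (↭-sym q)) (∈-resp-↭ q)
      ...   | inj₁ g   = inj₁ g
      ...   | inj₂ chs = inj₂ (Ks , q , cs , chs)

      -- Each component `K` is searched from a neighbour `a` of `v`, with all of the graph outside
      -- `K` as the new fixed part. That part is connected because every other component touches
      -- `v`. `D` holds the components already examined.
      examine : ∀ k D {v Y Ks} → Components Ks → All (Touches v) Ks → NoEdge (concat Ks) D → Conn (v ∷ D ++ Y) →
        X ↭ v ∷ (D ++ concat Ks) ++ Y → length (concat Ks) ≤ suc k → Good X ⊎ All (Child v Y) Ks
      examine k D [] [] n c p l = inj₂ []
      examine k D {v} {Y} (add {K = K} {Ks = Ks} _ cK nK cs) (t@(a , a∈ , v~a) ∷ ts) n c p l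
        with U , r ← ∈⇒↭∷ a∈
        with analyze k {a} {U} {v ∷ R ++ Y} (shorter r) (perm r) (conn-↭ r cK) connY
               (deg-pos {T = v ∷ R ++ Y} (here refl) (~-sym v~a))
        where
        R = D ++ concat Ks
        shorter : ∀ {U} → K ↭ a ∷ U → length U ≤ k
        shorter {U} r with s≤s h ← ≤-trans (≤-reflexive (≡.sym (↭-length r)))
                                    (≤-trans (m≤m+n (length K) (length (concat Ks)))
                                      (≤-trans (≤-reflexive (≡.sym (length-++ K))) l)) = h
        perm : ∀ {U} → K ↭ a ∷ U → X ↭ a ∷ U ++ (v ∷ R ++ Y)
        perm r = ↭-trans p (↭-trans
          (P.solve 5 (λ v d k ks y → (v ⊕ ((d ⊕ (k ⊕ ks)) ⊕ y)) ⊜ (k ⊕ (v ⊕ ((d ⊕ ks) ⊕ y)))) ↭-refl [ v ] D K (concat Ks) Y)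
          (++⁺ʳ (v ∷ R ++ Y) r))
        connY : Conn (v ∷ R ++ Y)
        connY = conn-↭ (P.solve 4 (λ v d ks y → (ks ⊕ (v ⊕ (d ⊕ y))) ⊜ (v ⊕ ((d ⊕ ks) ⊕ y))) ↭-refl [ v ] D (concat Ks) Y)
                  (conn-concat ts cs (here refl) c)
      ... | inj₁ g  = inj₁ g
      ... | inj₂ sh
        with examine k (D ++ K) cs ts (noEdge-++ʳ D (λ i → n (∈-++⁺ʳ K i)) (noEdge-sym nK)) conn′ perm′
               (≤-trans (≤-trans (m≤n+m _ (length K)) (≤-reflexive (≡.sym (length-++ K)))) l)
        where
        conn′ : Conn (v ∷ (D ++ K) ++ Y)
        conn′ = conn-↭ (P.solve 4 (λ v d k y → (k ⊕ (v ⊕ (d ⊕ y))) ⊜ (v ⊕ ((d ⊕ k) ⊕ y))) ↭-refl [ v ] D K Y)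
                  (conn-++ K cK c a∈ (here refl) (~-sym v~a))
        perm′ : X ↭ v ∷ ((D ++ K) ++ concat Ks) ++ Y
        perm′ = ↭-trans p (prep v (++⁺ʳ Y (↭-sym (++-assoc D K (concat Ks)))))
      ...   | inj₁ g   = inj₁ g
      ...   | inj₂ chs = inj₂ (toChild r v~a (noEdge-++ʳ D (λ i j → n (∈-++⁺ˡ i) j) nK) sh ∷ chs)

    -- The search starts at the first vertex with nothing fixed. Two children, or one `heavy` child,
    -- give the excess 3 asked for by `remove-root`; otherwise the graph is a vertex or an edge and
    -- the empty cover serves.
    connected-good : ∀ {v U} → X ≡ v ∷ U → Conn X → Good X
    connected-good {v} {U} refl c
      with children (length U) {v} {U} {[]} ≤-refl (↭-sym (++-identityʳ X)) c conn-[-]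
    ... | inj₁ g = g
    ... | inj₂ (Ks , q , cs , chs) = finish Ks q cs chs
      where
      p : ∀ Ks → U ↭ concat Ks → X ↭ v ∷ concat Ks ++ []
      p Ks q = ↭-trans (prep v q) (↭-sym (++-identityʳ (v ∷ concat Ks)))
      reduce : ∀ {Ks} → U ↭ concat Ks → Components Ks → (chs : All (Child v []) Ks) → 3 ≤ total chs → Good X
      reduce {Ks} q cs chs h = remove-root (p Ks q) (split cs chs conn-[]) h
      finish : ∀ Ks → U ↭ concat Ks → Components Ks → All (Child v []) Ks → Good X
      finish [] q cs [] = [] , cover-↭ (prep v (↭-sym q)) cover-single , z≤n
      finish (K ∷ []) q cs (leaf a r _ _ ∷ []) =
        [] , cover-↭ (prep v (↭-sym (↭-trans q (↭-trans (++-identityʳ K) r)))) cover-pair , z≤n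
      finish (K ∷ []) q cs chs@(heavy _ _ _ _ ∷ []) = reduce q cs chs ≤-refl
      finish (K ∷ _ ∷ _) q cs chs@(ch ∷ ch′ ∷ _) =
        reduce q cs chs (≤-trans (m≤m+n 3 1) (+-mono-≤ (excess≥2 ch) (≤-trans (excess≥2 ch′) (m≤m+n _ _))))
      -- Open children have a neighbour in `Y`, which is empty at the root.
      finish (K ∷ []) q cs (open₁ _ _ _ () ∷ [])

  conn⇒good : ∀ n X → length X < n → Unique X → Conn X → Good X
  conn⇒good (suc n) []      l u c = [] , (λ ()) , z≤n
  conn⇒good (suc n) (v ∷ U) (s≤s l) u c =
    Step.connected-good (v ∷ U) u (λ Z l′ → conn⇒good n Z (≤-trans l′ l)) refl c

-- The lower bound: from a cover to a colouring.

Unique-⊆⇒length≤ : {xs ys : List A} → Unique xs → (∀ {x} → x ∈ xs → x ∈ ys) → length xs ≤ length ys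
Unique-⊆⇒length≤ {xs = []} u f = z≤n
Unique-⊆⇒length≤ {xs = x ∷ xs} {ys} u@(_ ∷ u′) f with zs , p ← ∈⇒↭∷ (f (here refl)) =
  ≤-trans (s≤s (Unique-⊆⇒length≤ u′ (λ i → drop i (∈-resp-↭ p (f (there i)))))) (≤-reflexive (≡.sym (↭-length p)))
  where
  drop : ∀ {z zs} → z ∈ xs → z ∈ x ∷ zs → z ∈ zs
  drop i (here refl) = ⊥-elim (Unique[x∷xs]⇒x∉xs u i)
  drop i (there j)   = j

index-injective : {xs : List A} {x y : A} (i : x ∈ xs) (j : y ∈ xs) → Any.index i ≡ Any.index j → x ≡ y
index-injective {xs = xs} i j e =
  ≡.trans (lookup-index i) (≡.trans (cong (List.lookup xs) e) (≡.sym (lookup-index j)))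

module LowerBound (G : SimpleGraph) where

  private
    W = Fin (V G)

  open import Data.List.Membership.DecPropositional (≡-dec (Fin._≟_ {V G}) (Fin._≟_ {V G})) using () renaming (_∈?_ to _∈ₑ?_)
  open import Data.List.Membership.DecPropositional (Fin._≟_ {V G}) using (_∈?_)

  adj? : ∀ x y → Dec (Adj G x y)
  adj? x y = ((x , y) ∈ₑ? E G) ⊎-dec ((y , x) ∈ₑ? E G)

  edge-< : ∀ {x y} → (x , y) ∈ E G → x Fin.< y
  edge-< i = All.lookup (sorted G) i

  adjᵇ : Fin (V G) → Fin (V G) → Bool
  adjᵇ x y = does (adj? x y)

  adjᵇ-sym : ∀ x y → adjᵇ x y ≡ adjᵇ y x
  adjᵇ-sym x y = does-⇔ (mk⇔ Sum.swap Sum.swap) (adj? x y) (adj? y x)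

  adjᵇ-irrefl : ∀ x → adjᵇ x x ≡ false
  adjᵇ-irrefl x = dec-false (adj? x x) Sum.[ loop , loop ]
    where
    loop : (x , x) ∈ E G → ⊥
    loop i = <-irrefl refl (edge-< i)

  open Dissociation adjᵇ adjᵇ-sym adjᵇ-irrefl

  Adj⇒~ : ∀ {x y} → Adj G x y → x ~ y
  Adj⇒~ {x} {y} = dec-true (adj? x y)

  pairs : List W → List (W × W)
  pairs []      = []
  pairs (x ∷ L) = map (x ,_) (filter (adj? x) L) ++ pairs L

  length-filter-adj : ∀ x L → length (filter (adj? x) L) ≡ deg x L
  length-filter-adj x []      = refl
  length-filter-adj x (y ∷ L) with does (adj? x y)
  ... | true  = cong suc (length-filter-adj x L)
  ... | false = length-filter-adj x L

  length-pairs : ∀ L → length (pairs L) ≡ edges L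
  length-pairs []      = refl
  length-pairs (x ∷ L) = ≡.trans (length-++ (map (x ,_) (filter (adj? x) L)))
    (cong₂ _+_ (≡.trans (length-map (x ,_) (filter (adj? x) L)) (length-filter-adj x L)) (length-pairs L))

  -- In an increasing list a pair runs from the smaller vertex to the larger, which is how `E G`
  -- stores edges. Hence counting by `pairs` never exceeds `size G`.
  ∈-pairs : ∀ {L x y} → AllPairs Fin._<_ L → (x , y) ∈ pairs L → x ∈ L × (x , y) ∈ E G
  ∈-pairs {z ∷ L} (z< ∷ s) i with ∈-++⁻ (map (z ,_) (filter (adj? z) L)) i
  ... | inj₂ j with x∈ , e ← ∈-pairs s j = there x∈ , e
  ... | inj₁ j with y , j′ , refl ← ∈-map⁻ (z ,_) j with y∈ , a ← ∈-filter⁻ (adj? z) j′ = here refl , orient a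
    where
    orient : Adj G z y → (z , y) ∈ E G
    orient (inj₁ e) = e
    orient (inj₂ e) = ⊥-elim (<-asym (All.lookup z< y∈) (edge-< e))

  pairs-unique : ∀ {L} → AllPairs Fin._<_ L → Unique L → Unique (pairs L)
  pairs-unique []       []      = []
  pairs-unique {x ∷ L} (x< ∷ s) (_ ∷ u) =
    Unique.++⁺ (Unique.map⁺ (λ { refl → refl }) (Unique.filter⁺ (adj? x) u)) (pairs-unique s u) disjoint
    where
    disjoint : ∀ {e} → e ∈ map (x ,_) (filter (adj? x) L) × e ∈ pairs L → ⊥
    disjoint (i , j) with y , _ , refl ← ∈-map⁻ (x ,_) i = <-irrefl refl (All.lookup x< (proj₁ (∈-pairs s j)))

  edges≤size : edges (allFin (V G)) ≤ size G
  edges≤size = ≤-trans (≤-reflexive (≡.sym (length-pairs (allFin (V G)))))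
    (Unique-⊆⇒length≤ (pairs-unique sorted-allFin (Unique.allFin⁺ (V G))) (λ i → proj₂ (∈-pairs sorted-allFin i)))
    where
    sorted-allFin : AllPairs Fin._<_ (allFin (V G))
    sorted-allFin = AllPairs.tabulate⁺-< (λ i<j → i<j)

  reach⇒walk : ∀ {x y} → Reach G x y → Walk (allFin (V G)) x y
  reach⇒walk here       = stop
  reach⇒walk (step a r) = (Adj⇒~ a , ∈-allFin _) ◂ reach⇒walk r

  module _ (C : List W) (cover : PathCover (allFin (V G)) C) where

    colouring : Colouring G
    colouring x y with x ∈? C | y ∈? C
    ... | no _  | no _  = blue
    ... | _     | _     = red

    blue⇒∉ : ∀ x y → colouring x y ≡ blue → x ∉ C × y ∉ C
    blue⇒∉ x y e with x ∈? C | y ∈? C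
    blue⇒∉ x y e  | no p  | no q = p , q

    red⇒∈ : ∀ x y → colouring x y ≡ red → x ∈ C ⊎ y ∈ C
    red⇒∈ x y e with x ∈? C | y ∈? C
    red⇒∈ x y e  | yes p | _     = inj₁ p
    red⇒∈ x y e  | no _  | yes q = inj₂ q

    blue-edge : ∀ {x y} → ColEdge G colouring blue x y → x ~ y × x ∉ C × y ∉ C
    blue-edge (inj₁ (i , e)) = Adj⇒~ (inj₁ i) , blue⇒∉ _ _ e
    blue-edge (inj₂ (i , e)) = Adj⇒~ (inj₂ i) , Product.swap (blue⇒∉ _ _ e)

    red-edge : ∀ {x y} → ColEdge G colouring red x y → x ∈ C ⊎ y ∈ C
    red-edge (inj₁ (_ , e)) = red⇒∈ _ _ e
    red-edge (inj₂ (_ , e)) = Sum.swap (red⇒∈ _ _ e)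

    -- All three vertices avoid `C`, so the cover identifies the two neighbours of the middle one,
    -- against injectivity.
    no-blue-P₃ : HasMonoCopy G colouring blue P₃ → ⊥
    no-blue-P₃ (f , inj , h)
      with p , n₀ , n₁ ← blue-edge (h _ _ e01) | q , _ , n₂ ← blue-edge (h _ _ e12)
      with () ← inj (cover (∈-allFin _) (∈-allFin _) (∈-allFin _) n₁ n₀ n₂ (~-sym p) q)

    -- Each red edge has an end in `C`, and the edges of a matching share no ends, so the positions
    -- of these ends in `C` are distinct.
    red-nK₂⇒≤ : ∀ n → HasMonoCopy G colouring red (nK₂ n) → n ≤ length C
    red-nK₂⇒≤ n (f , inj , h) = injective⇒≤ {f = λ i → Any.index (proj₂ (end i))} λ {i} {j} e →
      cong proj₁ (inj {i , proj₁ (end i)} {j , proj₁ (end j)} (index-injective (proj₂ (end i)) (proj₂ (end j)) e))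
      where
      end : ∀ i → ∃ λ b → f (i , b) ∈ C
      end i with red-edge (h _ _ (medge i))
      ... | inj₁ m = false , m
      ... | inj₂ m = true , m

  lower : ∀ n → Connected G → Arrows G (nK₂ n) P₃ → 5 * n ≤ 2 * size G + 2
  lower n (_ , conn) arrows
    with C , cover , b ← conn⇒good (suc (length (allFin (V G)))) (allFin (V G)) ≤-refl (Unique.allFin⁺ (V G))
                           (λ {x} {y} _ _ → reach⇒walk (conn x y))
    with arrows (colouring C cover)
  ... | inj₂ bluecopy = ⊥-elim (no-blue-P₃ C cover bluecopy)
  ... | inj₁ redcopy  = ≤-trans (*-monoʳ-≤ 5 (red-nK₂⇒≤ C cover n redcopy))
    (≤-trans b (+-mono-≤ (*-monoʳ-≤ 2 edges≤size) ≤-refl))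

-- The upper bound: building monochromatic copies.

colour : ∀ G (c : Colouring G) {x y} → Adj G x y → ColEdge G c red x y ⊎ ColEdge G c blue x y
colour G c {x} {y} (inj₁ i) with c x y
... | red  = inj₁ (inj₁ (i , refl))
... | blue = inj₂ (inj₁ (i , refl))
colour G c {x} {y} (inj₂ i) with c y x
... | red  = inj₁ (inj₂ (i , refl))
... | blue = inj₂ (inj₂ (i , refl))

module _ {G : SimpleGraph} {c : Colouring G} where

  P₃-copy : ∀ {col x y z} → x ≢ y → y ≢ z → x ≢ z →
    ColEdge G c col x y → ColEdge G c col y z → HasMonoCopy G c col P₃
  P₃-copy {x = x} {y} {z} x≢y y≢z x≢z e e′ = f , (λ {i} {j} → inj i j) , λ { _ _ e01 → e ; _ _ e12 → e′ }
    where
    f : Fin 3 → Fin (V G)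
    f 0F = x
    f 1F = y
    f 2F = z
    inj : ∀ i j → f i ≡ f j → i ≡ j
    inj 0F 0F _ = refl
    inj 0F 1F p = ⊥-elim (x≢y p)
    inj 0F 2F p = ⊥-elim (x≢z p)
    inj 1F 0F p = ⊥-elim (x≢y (≡.sym p))
    inj 1F 1F _ = refl
    inj 1F 2F p = ⊥-elim (y≢z p)
    inj 2F 0F p = ⊥-elim (x≢z (≡.sym p))
    inj 2F 1F p = ⊥-elim (y≢z (≡.sym p))
    inj 2F 2F _ = refl

  nK₂-empty : ∀ {col} → HasMonoCopy G c col (nK₂ 0)
  nK₂-empty = (λ { (() , _) }) , (λ { {() , _} }) , λ { _ _ (medge ()) }

  _Avoids_ : ∀ {col n} → HasMonoCopy G c col (nK₂ n) → Fin (V G) → Set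
  M Avoids x = ∀ p → proj₁ M p ≢ x

  -- The second component records which vertices the longer matching still misses, so that another
  -- edge can be added after this one.
  nK₂-cons : ∀ {col n x y} (M : HasMonoCopy G c col (nK₂ n)) → x ≢ y → M Avoids x → M Avoids y →
    ColEdge G c col x y →
    Σ (HasMonoCopy G c col (nK₂ (suc n))) λ M′ → ∀ {z} → x ≢ z → y ≢ z → M Avoids z → M′ Avoids z
  nK₂-cons {n = n} {x} {y} (f , f-inj , h) x≢y ax ay e = (g , (λ {p} {q} → g-inj p q) , λ { _ _ (medge i) → g-edge i }) , avoids
    where
    g : Fin (suc n) × Bool → Fin (V G)
    g (Fin.zero  , false) = x
    g (Fin.zero  , true)  = y
    g (Fin.suc i , b)     = f (i , b)
    g-inj : ∀ p q → g p ≡ g q → p ≡ q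
    g-inj (Fin.zero  , false) (Fin.zero  , false) _ = refl
    g-inj (Fin.zero  , false) (Fin.zero  , true)  p = ⊥-elim (x≢y p)
    g-inj (Fin.zero  , true)  (Fin.zero  , false) p = ⊥-elim (x≢y (≡.sym p))
    g-inj (Fin.zero  , true)  (Fin.zero  , true)  _ = refl
    g-inj (Fin.zero  , false) (Fin.suc j , b)     p = ⊥-elim (ax _ (≡.sym p))
    g-inj (Fin.zero  , true)  (Fin.suc j , b)     p = ⊥-elim (ay _ (≡.sym p))
    g-inj (Fin.suc i , b)     (Fin.zero  , false) p = ⊥-elim (ax _ p)
    g-inj (Fin.suc i , b)     (Fin.zero  , true)  p = ⊥-elim (ay _ p)
    g-inj (Fin.suc i , b)     (Fin.suc j , b′)    p with refl ← f-inj p = refl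
    g-edge : ∀ i → ColEdge G c _ (g (i , false)) (g (i , true))
    g-edge Fin.zero    = e
    g-edge (Fin.suc i) = h _ _ (medge i)
    avoids : ∀ {z} → x ≢ z → y ≢ z → (∀ p → f p ≢ z) → ∀ p → g p ≢ z
    avoids nx ny nz (Fin.zero  , false) = nx
    avoids nx ny nz (Fin.zero  , true)  = ny
    avoids nx ny nz (Fin.suc i , b)     = nz (i , b)

-- If neither perfect matching of the 4-cycle is red, each contains a blue edge, and these two edges are adjacent.
square : ∀ {n} (G : SimpleGraph) (c : Colouring G) (s : Fin 4 → Fin (V G)) → Injective _≡_ _≡_ s →
  Adj G (s 0F) (s 1F) → Adj G (s 1F) (s 2F) → Adj G (s 2F) (s 3F) → Adj G (s 0F) (s 3F) →
  (M : HasMonoCopy G c red (nK₂ n)) → (∀ i p → proj₁ M p ≢ s i) →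
  HasMonoCopy G c red (nK₂ (2 + n)) ⊎ HasMonoCopy G c blue P₃
square {n} G c s s-inj a₀₁ a₁₂ a₂₃ a₀₃ M av =
  decide (colour G c a₀₁) (colour G c a₁₂) (colour G c a₂₃) (colour G c a₀₃)
  where
  Goal = HasMonoCopy G c red (nK₂ (2 + n)) ⊎ HasMonoCopy G c blue P₃
  apart : ∀ {i j} → i ≢ j → s i ≢ s j
  apart i≢j p = i≢j (s-inj p)
  match : ∀ {i j k l} → i ≢ j → k ≢ l → i ≢ k → j ≢ k → i ≢ l → j ≢ l →
    ColEdge G c red (s i) (s j) → ColEdge G c red (s k) (s l) → Goal
  match {i} {j} {k} {l} ij kl ik jk il jl e e′
    with M′ , av′ ← nK₂-cons {G} {c} M (apart ij) (av i) (av j) e =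
    inj₁ (proj₁ (nK₂-cons {G} {c} M′ (apart kl) (av′ (apart ik) (apart jk) (av k)) (av′ (apart il) (apart jl) (av l)) e′))
  path : ∀ {i j k} → i ≢ j → j ≢ k → i ≢ k → ColEdge G c blue (s i) (s j) → ColEdge G c blue (s j) (s k) → Goal
  path ij jk ik e e′ = inj₂ (P₃-copy {G} {c} (apart ij) (apart jk) (apart ik) e e′)
  Coloured : Fin 4 → Fin 4 → Set
  Coloured i j = ColEdge G c red (s i) (s j) ⊎ ColEdge G c blue (s i) (s j)
  decide : Coloured 0F 1F → Coloured 1F 2F → Coloured 2F 3F → Coloured 0F 3F → Goal
  decide (inj₁ e) _ (inj₁ e′) _ = match (λ ()) (λ ()) (λ ()) (λ ()) (λ ()) (λ ()) e e′
  decide _ (inj₁ e) _ (inj₁ e′) = match (λ ()) (λ ()) (λ ()) (λ ()) (λ ()) (λ ()) e e′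
  decide (inj₂ e) (inj₂ e′) _ _ = path (λ ()) (λ ()) (λ ()) e e′
  decide (inj₂ e) _ _ (inj₂ e′) = path (λ ()) (λ ()) (λ ()) (Sum.swap e) e′
  decide _ (inj₂ e) (inj₂ e′) _ = path (λ ()) (λ ()) (λ ()) e e′
  decide _ _ (inj₂ e) (inj₂ e′) = path (λ ()) (λ ()) (λ ()) e (Sum.swap e′)

-- Connectedness and the two smallest extremal graphs.

reach-trans : ∀ {G x y z} → Reach G x y → Reach G y z → Reach G x z
reach-trans here       r′ = r′
reach-trans (step a r) r′ = step a (reach-trans r r′)

reach-sym : ∀ {G x y} → Reach G x y → Reach G y x
reach-sym here       = here
reach-sym (step a r) = reach-trans (reach-sym r) (step (Sum.swap a) here)

connected-from : ∀ {G} → 0 < V G → (r : Fin (V G)) → (∀ x → Reach G r x) → Connected G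
connected-from p r f = p , λ x y → reach-trans (reach-sym (f x)) (f y)

cherry : SimpleGraph
cherry = record
  { V = 3 ; E = (0F , 1F) ∷ (1F , 2F) ∷ []
  ; sorted = s≤s z≤n ∷ s≤s (s≤s z≤n) ∷ []
  ; unique = ((λ ()) ∷ []) ∷ [] ∷ [] }

cherry-connected : Connected cherry
cherry-connected = connected-from (s≤s z≤n) 0F λ
  { 0F → here
  ; 1F → step (inj₁ (here refl)) here
  ; 2F → step (inj₁ (here refl)) (step (inj₁ (there (here refl))) here) }

cherry-arrows : Arrows cherry (nK₂ 1) P₃
cherry-arrows c with colour cherry c {0F} {1F} (inj₁ (here refl)) | colour cherry c {1F} {2F} (inj₁ (there (here refl)))
... | inj₁ e | _       = inj₁ (proj₁ (nK₂-cons {cherry} {c} (nK₂-empty {cherry} {c}) (λ ()) (λ { (() , _) }) (λ { (() , _) }) e))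
... | inj₂ _ | inj₁ e  = inj₁ (proj₁ (nK₂-cons {cherry} {c} (nK₂-empty {cherry} {c}) (λ ()) (λ { (() , _) }) (λ { (() , _) }) e))
... | inj₂ e | inj₂ e′ = inj₂ (P₃-copy {cherry} {c} (λ ()) (λ ()) (λ ()) e e′)

C₄ : SimpleGraph
C₄ = record
  { V = 4 ; E = (0F , 1F) ∷ (1F , 2F) ∷ (2F , 3F) ∷ (0F , 3F) ∷ []
  ; sorted = s≤s z≤n ∷ s≤s (s≤s z≤n) ∷ s≤s (s≤s (s≤s z≤n)) ∷ s≤s z≤n ∷ []
  ; unique = ((λ ()) ∷ (λ ()) ∷ (λ ()) ∷ []) ∷ ((λ ()) ∷ (λ ()) ∷ []) ∷ ((λ ()) ∷ []) ∷ [] ∷ [] }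

C₄-connected : Connected C₄
C₄-connected = connected-from (s≤s z≤n) 0F λ
  { 0F → here
  ; 1F → step (inj₁ (here refl)) here
  ; 2F → step (inj₁ (here refl)) (step (inj₁ (there (here refl))) here)
  ; 3F → step (inj₁ (there (there (there (here refl))))) here }

C₄-arrows : Arrows C₄ (nK₂ 2) P₃
C₄-arrows c = square C₄ c (λ i → i) (λ p → p)
  (inj₁ (here refl)) (inj₁ (there (here refl))) (inj₁ (there (there (here refl)))) (inj₁ (there (there (there (here refl)))))
  (nK₂-empty {C₄} {c}) (λ { _ (() , _) })

-- Attaching a 4-cycle by a bridge.

module Extend (G : SimpleGraph) (r : Fin (V G)) where

  lift : Fin (V G) → Fin (4 + V G)
  lift x = Fin.suc (Fin.suc (Fin.suc (Fin.suc x)))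

  lift² : Fin (V G) × Fin (V G) → Fin (4 + V G) × Fin (4 + V G)
  lift² (x , y) = lift x , lift y

  corner : Fin 4 → Fin (4 + V G)
  corner i = i Fin.↑ˡ V G

  corner≢lift : ∀ i x → lift x ≢ corner i
  corner≢lift 0F x ()
  corner≢lift 1F x ()
  corner≢lift 2F x ()
  corner≢lift 3F x ()

  fresh : ∀ {y} i L → All ((corner i , y) ≢_) (map lift² L)
  fresh i []      = []
  fresh i (e ∷ L) = (λ p → corner≢lift i _ (≡.sym (cong proj₁ p))) ∷ fresh i L

  -- The cycle takes the four lowest numbers and old vertices move up by four, so that the bridge
  -- and the lifted edges are stored in increasing order.
  extension : SimpleGraph
  extension = record
    { V = 4 + V G
    ; E = (0F , 1F) ∷ (1F , 2F) ∷ (2F , 3F) ∷ (0F , 3F) ∷ (0F , lift r) ∷ map lift² (E G)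
    ; sorted = s≤s z≤n ∷ s≤s (s≤s z≤n) ∷ s≤s (s≤s (s≤s z≤n)) ∷ s≤s z≤n ∷ s≤s z≤n
        ∷ All.map⁺ (All.map (λ p → s≤s (s≤s (s≤s (s≤s p)))) (sorted G))
    ; unique = ((λ ()) ∷ (λ ()) ∷ (λ ()) ∷ (λ ()) ∷ fresh 0F (E G))
        ∷ ((λ ()) ∷ (λ ()) ∷ (λ ()) ∷ fresh 1F (E G))
        ∷ ((λ ()) ∷ (λ ()) ∷ fresh 2F (E G))
        ∷ ((λ ()) ∷ fresh 0F (E G))
        ∷ fresh 0F (E G)
        ∷ Unique.map⁺ (λ { refl → refl }) (unique G) }

  ∈-lift : ∀ {x y} → (x , y) ∈ E G → (lift x , lift y) ∈ E extension
  ∈-lift i = there (there (there (there (there (∈-map⁺ lift² i)))))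

  reach-lift : ∀ {x y} → Reach G x y → Reach extension (lift x) (lift y)
  reach-lift here              = here
  reach-lift (step (inj₁ i) w) = step (inj₁ (∈-lift i)) (reach-lift w)
  reach-lift (step (inj₂ i) w) = step (inj₂ (∈-lift i)) (reach-lift w)

  extension-connected : Connected G → Connected extension
  extension-connected (_ , conn) = connected-from (s≤s z≤n) 0F λ
    { 0F → here
    ; 1F → step (inj₁ (here refl)) here
    ; 2F → step (inj₁ (here refl)) (step (inj₁ (there (here refl))) here)
    ; 3F → step (inj₁ (there (there (there (here refl))))) here
    ; (Fin.suc (Fin.suc (Fin.suc (Fin.suc x)))) →
        step (inj₁ (there (there (there (there (here refl)))))) (reach-lift (conn r x)) }

  module _ (c : Colouring extension) where

    restrict : Colouring G
    restrict x y = c (lift x) (lift y)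

    copy-lift : ∀ {col H} → HasMonoCopy G restrict col H → HasMonoCopy extension c col H
    copy-lift (f , inj , h) = (λ p → lift (f p)) , (λ p → inj (lift-inj p)) , λ a b e → colEdge-lift (h a b e)
      where
      lift-inj : ∀ {x y} → lift x ≡ lift y → x ≡ y
      lift-inj refl = refl
      colEdge-lift : ∀ {col x y} → ColEdge G restrict col x y → ColEdge extension c col (lift x) (lift y)
      colEdge-lift (inj₁ (i , e)) = inj₁ (∈-lift i , e)
      colEdge-lift (inj₂ (i , e)) = inj₂ (∈-lift i , e)

  -- A red matching found in the old part misses all four corners, so the new cycle either adds two
  -- red edges to it or contains a blue `P₃`.
  extension-arrows : ∀ {n} → Arrows G (nK₂ n) P₃ → Arrows extension (nK₂ (2 + n)) P₃
  extension-arrows arrows c with arrows (restrict c)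
  ... | inj₂ b = inj₂ (copy-lift c b)
  ... | inj₁ M = square extension c corner (↑ˡ-injective (V G) _ _)
    (inj₁ (here refl)) (inj₁ (there (here refl))) (inj₁ (there (there (here refl)))) (inj₁ (there (there (there (here refl)))))
    (copy-lift c M) (λ i p → corner≢lift i (proj₁ M p))

-- Raising `n` by 2 raises the value by exactly 5: the four edges of a new cycle and its bridge.
upper : ∀ n → 1 ≤ n → Σ SimpleGraph λ G → Connected G × Arrows G (nK₂ n) P₃ × size G ≡ (5 * n ∸ 1) / 2
upper 1 _ = cherry , cherry-connected , cherry-arrows , refl
upper 2 _ = C₄ , C₄-connected , C₄-arrows , refl
upper (suc (suc n@(suc k))) _ with G , conn , arrows , s ← upper n (s≤s z≤n) =
  extension , extension-connected conn , extension-arrows arrows , size-eq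
  where
  open Extend G (Fin.fromℕ< (proj₁ conn))
  -- With `n` equal to `suc k`, both multiples of 5 are written as successors so that the truncated
  -- `∸ 1` computes.
  eq : ∀ k → 5 * (3 + k) ≡ suc (10 + (4 + 5 * k))
  eq = solve-∀
  eq′ : ∀ k → suc (4 + 5 * k) ≡ 5 * suc k
  eq′ = solve-∀
  size-eq : 5 + length (map lift² (E G)) ≡ (5 * (2 + n) ∸ 1) / 2
  size-eq = begin
    5 + length (map lift² (E G))   ≡⟨ cong (5 +_) (≡.trans (length-map lift² (E G)) s) ⟩
    5 + (5 * n ∸ 1) / 2            ≡⟨ cong (λ m → 5 + (m ∸ 1) / 2) (eq′ k) ⟨
    5 + (4 + 5 * k) / 2            ≡⟨ +-distrib-/-∣ˡ {10} (4 + 5 * k) {2} (divides 5 refl) ⟨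
    (10 + (4 + 5 * k)) / 2         ≡⟨ cong (λ m → (m ∸ 1) / 2) (eq k) ⟨
    (5 * (2 + n) ∸ 1) / 2          ∎
    where open ≡.≡-Reasoning

theorem2 : (n : ℕ) → 1 ≤ n → IsConnSizeRamsey (nK₂ n) P₃ ((5 * n ∸ 1) / 2)
theorem2 n 1≤n = upper n 1≤n , λ G conn arrows → ≤-pred (m<n*o⇒m/o<n (bound n 1≤n G (LowerBound.lower G n conn arrows)))
  where
  eq : ∀ s → 2 * s + 2 ≡ suc s * 2
  eq = solve-∀
  -- From `5 * n ≤ 2 * size G + 2` the numerator `5 * n ∸ 1` is strictly below twice `suc (size G)`,
  -- so its half rounded down is at most `size G`.
  bound : ∀ n → 1 ≤ n → ∀ G → 5 * n ≤ 2 * size G + 2 → 5 * n ∸ 1 < suc (size G) * 2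
  bound (suc n) _ G h = ≤-trans h (≤-reflexive (eq (size G)))
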